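{- Let $\Sigma$ be an ordered alphabet with $|\Sigma|=3$. There are only finitely many $M$-equivalence classes over $\Sigma$ such that all words in the class are square-free. Furthermore, every such class is a $1$-equivalence class.
   Context: Write $\Sigma=\{a<b<c\}$. For words $w,v$, $|w|_v$ is the number of occurrences of $v$ as a scattered subword of $w$. A word is square-free if it has no factor (contiguous subword) of the form $uu$ with $u$ nonempty. The Parikh matrix of $w$ with respect to $a<b<c$ is the $4\times4$ upper triangular matrix with unit diagonal whose entries above the diagonal are: $(1,2)=|w|_a$, $(1,3)=|w|_{ab}$, $(1,4)=|w|_{abc}$, $(2,3)=|w|_b$, $(2,4)=|w|_{bc}$, $(3,4)=|w|_c$. Two words are $M$-equivalent iff they have the same Parikh matrix; the $M$-equivalence classes are the equivalence classes of this relation. A word $w$ is $1$-equivalent to $w'$ iff $w'$ can be obtained from $w$ by finitely many applications of the rule: replace a factor $ac$ by $ca$ or a factor $ca$ by $ac$ (i.e. $xacy\leftrightarrow xcay$ for words $x,y$); a $1$-equivalence class is an equivalence class of this relation. -}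

module Defs where

open import Data.Nat using (ℕ; zero; suc; _+_)
open import Data.List using (List; []; _∷_; _++_)
open import Data.Vec using (Vec) renaming ([] to []ᵥ; _∷_ to _∷ᵥ_)
open import Data.Product using (Σ; ∃; _×_; _,_)
open import Data.Sum using (_⊎_)
open import Relation.Nullary using (¬_)
open import Relation.Binary.PropositionalEquality using (_≡_; _≢_)
open import Relation.Binary.Construct.Closure.ReflexiveTransitive using (Star)

-- The ordered alphabet Σ = {a < b < c}; the order is fixed by the
-- choice of which letters are used in the Parikh matrix entries below.
data Letter : Set where
  a b c : Letter

Word : Set
Word = List Letter

eqL : Letter → Letter → ℕ
eqL a a = 1
eqL b b = 1
eqL c c = 1
eqL _ _ = 0

occ : Word → Word → ℕ
occ w       []      = 1
occ []      (_ ∷ _) = 0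
occ (x ∷ w) (y ∷ v) = occ w (y ∷ v) + (if1 (eqL x y) (occ w v))
  where
  if1 : ℕ → ℕ → ℕ
  if1 zero    _ = 0
  if1 (suc _) n = n

parikh : Word → Vec (Vec ℕ 4) 4
parikh w =
  (1 ∷ᵥ occ w (a ∷ []) ∷ᵥ occ w (a ∷ b ∷ []) ∷ᵥ occ w (a ∷ b ∷ c ∷ []) ∷ᵥ []ᵥ) ∷ᵥ
  (0 ∷ᵥ 1              ∷ᵥ occ w (b ∷ [])     ∷ᵥ occ w (b ∷ c ∷ [])     ∷ᵥ []ᵥ) ∷ᵥ
  (0 ∷ᵥ 0              ∷ᵥ 1                  ∷ᵥ occ w (c ∷ [])         ∷ᵥ []ᵥ) ∷ᵥ
  (0 ∷ᵥ 0              ∷ᵥ 0                  ∷ᵥ 1                      ∷ᵥ []ᵥ) ∷ᵥ []ᵥ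

_≡M_ : Word → Word → Set
w ≡M w' = parikh w ≡ parikh w'

SquareFree : Word → Set
SquareFree w = ¬ (Σ Word λ x → Σ Word λ u → Σ Word λ y →
                   (u ≢ []) × (w ≡ x ++ u ++ u ++ y))

data Step : Word → Word → Set where
  ac→ca : ∀ x y → Step (x ++ a ∷ c ∷ y) (x ++ c ∷ a ∷ y)
  ca→ac : ∀ x y → Step (x ++ c ∷ a ∷ y) (x ++ a ∷ c ∷ y)

_≡₁_ : Word → Word → Set
_≡₁_ = Star Step

ClassSquareFree : Word → Set
ClassSquareFree w = ∀ w' → w ≡M w' → SquareFree w'

{-# OPTIONS --safe #-}
module Submission where

-- The commutation ac = ca alone already forces finiteness.  Parikh matrices are
-- multiplicative, so every factor of a word with square-free class has a square-free
-- class too.  In particular no factor equals, up to ac = ca, one of 21 fixed words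
-- containing a square; exhaustive search shows that only 62 words satisfy this, all of
-- length at most 7.  Every word M-equivalent to one with square-free class is again among
-- these 62, so it remains to compare their Parikh matrices and their normal forms for
-- ac = ca pairwise.

open import Defs
open import Data.Empty using (⊥-elim)
open import Data.List using (List; []; _∷_; _++_; length; take; drop; filter; concat; map; upTo; cartesianProductWith)
open import Data.List.Membership.Propositional using (_∈_)
open import Data.List.Membership.Propositional.Properties using (∈-filter⁺; ∈-cartesianProductWith⁺; ∈-concat⁺′; ∈-map⁺; ∈-upTo⁺)
open import Data.List.Properties using (++-assoc; take++drop≡id) renaming (≡-dec to List-≡-dec)
open import Data.List.Relation.Unary.All using (All; all?) renaming (lookup to All-lookup)
open import Data.List.Relation.Unary.Any using (Any; here; there; any?; satisfied)
open import Data.List.Relation.Unary.Any.Properties using (¬Any[])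
open import Data.Nat using (ℕ; zero; suc; _+_; _*_; _<?_; _∸_)
open import Data.Nat.Properties using (+-identityʳ; +-comm; m+[n∸m]≡n; ≮⇒≥; _≟_)
open import Data.Nat.Tactic.RingSolver using (solve-∀)
open import Data.Product using (Σ; ∃; _×_; _,_)
open import Data.Vec using (Vec; lookup)
open import Data.Vec.Properties using () renaming (≡-dec to Vec-≡-dec)
open import Data.Fin using (Fin; #_)
open import Function using (_∘_)
open import Function.Bundles using (_⇔_; mk⇔)
open import Relation.Binary.Construct.Closure.ReflexiveTransitive using (ε; _◅_; _◅◅_; gmap; reverse; fold)
open import Relation.Binary.Definitions using (DecidableEquality)
open import Relation.Binary.PropositionalEquality
open import Relation.Nullary using (¬_; Dec; yes; no)
open import Relation.Nullary.Decidable using (from-yes; ¬?; _→-dec_)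

-- Multiplicativity of the Parikh matrix

-- conv f v p = Σ f p₁ · |v|_{p₂}, over all factorizations p = p₁ p₂.
conv : (Word → ℕ) → Word → Word → ℕ
conv f v []      = f []
conv f v (z ∷ p) = f [] * occ v (z ∷ p) + conv (f ∘ (z ∷_)) v p

conv-cong : ∀ {f g} → (∀ q → f q ≡ g q) → ∀ v p → conv f v p ≡ conv g v p
conv-cong f≗g v []      = f≗g []
conv-cong f≗g v (z ∷ p) =
  cong₂ _+_ (cong (_* occ v (z ∷ p)) (f≗g [])) (conv-cong (f≗g ∘ (z ∷_)) v p)

conv-0 : ∀ v p → conv (λ _ → 0) v p ≡ 0
conv-0 v []      = refl
conv-0 v (z ∷ p) = conv-0 v p

conv-+ : ∀ f g v p → conv (λ q → f q + g q) v p ≡ conv f v p + conv g v p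
conv-+ f g v []      = refl
conv-+ f g v (z ∷ p)
  rewrite conv-+ (f ∘ (z ∷_)) (g ∘ (z ∷_)) v p
  = interchange (f []) (g []) (occ v (z ∷ p)) (conv (f ∘ (z ∷_)) v p) (conv (g ∘ (z ∷_)) v p)
  where
  interchange : ∀ k l m s t → (k + l) * m + (s + t) ≡ (k * m + s) + (l * m + t)
  interchange = solve-∀

-- An occurrence of `p` in `u ++ v` takes a prefix of `p` from `u` and the rest from `v`. When `x`
-- equals `z`, the occurrences using this `x` contribute a second convolution, which `conv-+` merges
-- with the first.
occ-++ : ∀ u v p → occ (u ++ v) p ≡ conv (occ u) v p
occ-++ u       v []      = refl
occ-++ []      v (z ∷ p) rewrite conv-0 v p =
  sym (trans (+-identityʳ _) (+-identityʳ _))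
occ-++ (x ∷ u) v (z ∷ p) with eqL x z
... | zero  = trans (+-identityʳ _) (trans (occ-++ u v (z ∷ p))
                (cong (1 * occ v (z ∷ p) +_)
                  (conv-cong (λ q → sym (+-identityʳ (occ u (z ∷ q)))) v p)))
... | suc _
  rewrite occ-++ u v (z ∷ p) | occ-++ u v p
        | conv-+ (occ u ∘ (z ∷_)) (occ u) v p
  = assoc (occ v (z ∷ p)) (conv (occ u ∘ (z ∷_)) v p) (conv (occ u) v p)
  where
  assoc : ∀ k l m → (1 * k + l) + m ≡ 1 * k + (l + m)
  assoc = solve-∀

≡M-entry : ∀ {u v} (i j : Fin 4) → u ≡M v → lookup (lookup (parikh u) i) j ≡ lookup (lookup (parikh v) i) j
≡M-entry i j = cong (λ m → lookup (lookup m i) j)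

-- The subwords counted in the matrix are the nonempty factors of abc, a set closed under nonempty
-- prefixes and suffixes, so every `conv` expands into entries of the two given matrices.
≡M-++ : ∀ {u u' v v'} → u ≡M u' → v ≡M v' → (u ++ v) ≡M (u' ++ v')
≡M-++ {u} {u'} {v} {v'} p q
  rewrite occ-++ u v (a ∷ []) | occ-++ u' v' (a ∷ [])
        | occ-++ u v (b ∷ []) | occ-++ u' v' (b ∷ [])
        | occ-++ u v (c ∷ []) | occ-++ u' v' (c ∷ [])
        | occ-++ u v (a ∷ b ∷ []) | occ-++ u' v' (a ∷ b ∷ [])
        | occ-++ u v (b ∷ c ∷ []) | occ-++ u' v' (b ∷ c ∷ [])
        | occ-++ u v (a ∷ b ∷ c ∷ []) | occ-++ u' v' (a ∷ b ∷ c ∷ [])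
        | ≡M-entry {u} {u'} (# 0) (# 1) p | ≡M-entry {v} {v'} (# 0) (# 1) q
        | ≡M-entry {u} {u'} (# 0) (# 2) p | ≡M-entry {v} {v'} (# 0) (# 2) q
        | ≡M-entry {u} {u'} (# 0) (# 3) p | ≡M-entry {v} {v'} (# 0) (# 3) q
        | ≡M-entry {u} {u'} (# 1) (# 2) p | ≡M-entry {v} {v'} (# 1) (# 2) q
        | ≡M-entry {u} {u'} (# 1) (# 3) p | ≡M-entry {v} {v'} (# 1) (# 3) q
        | ≡M-entry {u} {u'} (# 2) (# 3) p | ≡M-entry {v} {v'} (# 2) (# 3) q
  = refl

-- The matrix counts neither ac nor ca, so these two words agree by computation; multiplicativity
-- adds the context.
ac≡Mca : ∀ x y → (x ++ a ∷ c ∷ y) ≡M (x ++ c ∷ a ∷ y)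
ac≡Mca x y = ≡M-++ {x} {x} {a ∷ c ∷ y} {c ∷ a ∷ y} refl
  (≡M-++ {a ∷ c ∷ []} {c ∷ a ∷ []} {y} {y} refl refl)

≡₁⇒≡M : ∀ {u v} → u ≡₁ v → u ≡M v
≡₁⇒≡M = fold _≡M_ (λ s p → trans (step s) p) refl
  where
  step : ∀ {u v} → Step u v → u ≡M v
  step (ac→ca x y) = ac≡Mca x y
  step (ca→ac x y) = sym (ac≡Mca x y)

-- Normal forms for the commutation ac = ca

≡₁-∷ : ∀ z {u v} → u ≡₁ v → (z ∷ u) ≡₁ (z ∷ v)
≡₁-∷ z = gmap (z ∷_) step
  where
  step : ∀ {u v} → Step u v → Step (z ∷ u) (z ∷ v)
  step (ac→ca x y) = ac→ca (z ∷ x) y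
  step (ca→ac x y) = ca→ac (z ∷ x) y

≡₁-sym : ∀ {u v} → u ≡₁ v → v ≡₁ u
≡₁-sym = reverse step
  where
  step : ∀ {u v} → Step u v → Step v u
  step (ac→ca x y) = ca→ac x y
  step (ca→ac x y) = ac→ca x y

-- The `c` passes only the leading `a`s, so `nf` sorts each maximal `b`-free block into `a`s
-- followed by `c`s.
insertC : Word → Word
insertC (a ∷ w) = a ∷ insertC w
insertC w       = c ∷ w

nf : Word → Word
nf []      = []
nf (a ∷ w) = a ∷ nf w
nf (b ∷ w) = b ∷ nf w
nf (c ∷ w) = insertC (nf w)

insertC-≡₁ : ∀ w → (c ∷ w) ≡₁ insertC w
insertC-≡₁ []      = ε
insertC-≡₁ (a ∷ w) = ca→ac [] w ◅ ≡₁-∷ a (insertC-≡₁ w)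
insertC-≡₁ (b ∷ w) = ε
insertC-≡₁ (c ∷ w) = ε

nf-≡₁ : ∀ w → w ≡₁ nf w
nf-≡₁ []      = ε
nf-≡₁ (a ∷ w) = ≡₁-∷ a (nf-≡₁ w)
nf-≡₁ (b ∷ w) = ≡₁-∷ b (nf-≡₁ w)
nf-≡₁ (c ∷ w) = ≡₁-∷ c (nf-≡₁ w) ◅◅ insertC-≡₁ (nf w)

nf-≡⇒≡₁ : ∀ u v → nf u ≡ nf v → u ≡₁ v
nf-≡⇒≡₁ u v p = subst (u ≡₁_) p (nf-≡₁ u) ◅◅ ≡₁-sym (nf-≡₁ v)

-- Words with square-free class

ClassSquareFree-resp-≡M : ∀ {u v} → u ≡M v → ClassSquareFree u → ClassSquareFree v
ClassSquareFree-resp-≡M p sf w q = sf w (trans p q)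

ClassSquareFree-tail : ∀ z {w} → ClassSquareFree (z ∷ w) → ClassSquareFree w
ClassSquareFree-tail z {w} sf w' w≡w' (x , u , y , u≢[] , eq) =
  sf (z ∷ w') (≡M-++ {z ∷ []} {z ∷ []} {w} {w'} refl w≡w') (z ∷ x , u , y , u≢[] , cong (z ∷_) eq)

-- sq x r u y stands for the word x (r u) (r u) y.
data SquareWord : Set where
  sq : Word → Letter → Word → Word → SquareWord

⟦_⟧ : SquareWord → Word
⟦ sq x r u y ⟧ = x ++ (r ∷ u) ++ (r ∷ u) ++ y

⟦⟧++-not-squareFree : ∀ s v → ¬ SquareFree (⟦ s ⟧ ++ v)
⟦⟧++-not-squareFree (sq x r u y) v sf = sf (x , r ∷ u , y ++ v , (λ ()) , eq)
  where
  ru = r ∷ u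
  eq : (x ++ ru ++ ru ++ y) ++ v ≡ x ++ ru ++ ru ++ (y ++ v)
  eq = trans (++-assoc x (ru ++ ru ++ y) v) (cong (x ++_)
         (trans (++-assoc ru (ru ++ y) v) (cong (ru ++_) (++-assoc ru y v))))

StartsWith : Word → SquareWord → Set
StartsWith w s = nf (take (length ⟦ s ⟧) w) ≡ nf ⟦ s ⟧

-- Replacing the prefix by `⟦ s ⟧` stays in the M-class and exposes the square.
startsWith⇒¬ClassSquareFree : ∀ w s → StartsWith w s → ¬ ClassSquareFree w
startsWith⇒¬ClassSquareFree w s p sf =
  ⟦⟧++-not-squareFree s (drop n w)
    (sf _ (subst (_≡M (⟦ s ⟧ ++ drop n w)) (take++drop≡id n w)
      (≡M-++ {take n w} {⟦ s ⟧} {drop n w} {drop n w} (≡₁⇒≡M (nf-≡⇒≡₁ (take n w) ⟦ s ⟧ p)) refl)))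
  where n = length ⟦ s ⟧

-- Letters outside the square matter where commutation can break it up: aca is square-free, but
-- 1-equivalent to aac, which is `⟦ sq [] a [] (c ∷ []) ⟧`.
squares : List SquareWord
squares =
  sq [] a [] [] ∷
  sq [] b [] [] ∷
  sq [] c [] [] ∷
  sq [] a [] (c ∷ []) ∷
  sq (a ∷ []) c [] [] ∷
  sq [] b (a ∷ []) [] ∷
  sq [] a (b ∷ []) [] ∷
  sq [] c (b ∷ []) [] ∷
  sq [] b (c ∷ []) [] ∷
  sq [] b (a ∷ []) (c ∷ []) ∷
  sq (c ∷ []) a (b ∷ []) [] ∷
  sq (a ∷ []) c (b ∷ []) [] ∷
  sq [] b (c ∷ []) (a ∷ []) ∷
  sq [] c (b ∷ a ∷ []) [] ∷
  sq [] b (c ∷ a ∷ []) [] ∷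
  sq [] c (a ∷ b ∷ []) [] ∷
  sq [] a (b ∷ c ∷ []) [] ∷
  sq [] b (c ∷ b ∷ a ∷ []) [] ∷
  sq [] c (b ∷ a ∷ b ∷ []) [] ∷
  sq [] a (b ∷ c ∷ b ∷ []) [] ∷
  sq [] b (a ∷ b ∷ c ∷ []) [] ∷ []

_≟L_ : DecidableEquality Letter
a ≟L a = yes refl
a ≟L b = no λ ()
a ≟L c = no λ ()
b ≟L a = no λ ()
b ≟L b = yes refl
b ≟L c = no λ ()
c ≟L a = no λ ()
c ≟L b = no λ ()
c ≟L c = yes refl

_≟W_ : DecidableEquality Word
_≟W_ = List-≡-dec _≟L_

startsWithSquare? : ∀ w → Dec (Any (StartsWith w) squares)
startsWithSquare? w = any? (λ s → nf (take (length ⟦ s ⟧) w) ≟W nf ⟦ s ⟧) squares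

letters : List Letter
letters = a ∷ b ∷ c ∷ []

∈-letters : ∀ z → z ∈ letters
∈-letters a = here refl
∈-letters b = there (here refl)
∈-letters c = there (there (here refl))

-- Words grow at the front, so testing prefixes is enough: the tail has already passed the test at
-- every later position.
candidatesOfLength : ℕ → List Word
candidatesOfLength zero    = [] ∷ []
candidatesOfLength (suc n) =
  filter (¬? ∘ startsWithSquare?) (cartesianProductWith _∷_ letters (candidatesOfLength n))

candidates : List Word
candidates = concat (map candidatesOfLength (upTo 8))

candidatesOfLength-≥8 : ∀ k → candidatesOfLength (k + 8) ≡ []
-- `refl` evaluates the search up to length 8, where nothing survives. With 8 as right summand,
-- `suc k + 8` unfolds to one more extension step, and extending the empty list yields the empty
-- list.
candidatesOfLength-≥8 zero    = refl
candidatesOfLength-≥8 (suc k) =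
  cong (filter (¬? ∘ startsWithSquare?) ∘ cartesianProductWith _∷_ letters) (candidatesOfLength-≥8 k)

ClassSquareFree⇒∈-candidatesOfLength : ∀ w → ClassSquareFree w → w ∈ candidatesOfLength (length w)
ClassSquareFree⇒∈-candidatesOfLength []      sf = here refl
ClassSquareFree⇒∈-candidatesOfLength (z ∷ w) sf =
  ∈-filter⁺ (¬? ∘ startsWithSquare?)
    (∈-cartesianProductWith⁺ _∷_ (∈-letters z)
      (ClassSquareFree⇒∈-candidatesOfLength w (ClassSquareFree-tail z {w} sf)))
    (λ bad → let s , p = satisfied bad in startsWith⇒¬ClassSquareFree (z ∷ w) s p sf)

ClassSquareFree⇒∈-candidates : ∀ w → ClassSquareFree w → w ∈ candidates
ClassSquareFree⇒∈-candidates w sf with length w <? 8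
... | yes l<8 = ∈-concat⁺′ w∈ (∈-map⁺ candidatesOfLength (∈-upTo⁺ l<8))
  where w∈ = ClassSquareFree⇒∈-candidatesOfLength w sf
... | no  l≮8 = ⊥-elim (¬Any[] (subst (w ∈_) none (ClassSquareFree⇒∈-candidatesOfLength w sf)))
  where
  length≡ : length w ≡ (length w ∸ 8) + 8
  length≡ = trans (sym (m+[n∸m]≡n (≮⇒≥ l≮8))) (+-comm 8 (length w ∸ 8))
  none : candidatesOfLength (length w) ≡ []
  none = trans (cong candidatesOfLength length≡) (candidatesOfLength-≥8 (length w ∸ 8))

-- Decided by evaluation over all pairs. Phrasing the conclusion with `nf` makes it a decidable
-- equality, from which `nf-≡⇒≡₁` recovers `_≡₁_`.
candidates-≡M⇒nf-≡ : All (λ u → All (λ v → u ≡M v → nf u ≡ nf v) candidates) candidates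
candidates-≡M⇒nf-≡ = from-yes
  (all? (λ u → all? (λ v → (parikh u ≟P parikh v) →-dec (nf u ≟W nf v)) candidates) candidates)
  where
  _≟P_ : DecidableEquality (Vec (Vec ℕ 4) 4)
  _≟P_ = Vec-≡-dec (Vec-≡-dec _≟_)

theorem4p3 : Σ (List Word) (λ reps →
    ∀ w → ClassSquareFree w → ∃ λ r → (r ∈ reps) × (r ≡M w))
    × (∀ w → ClassSquareFree w → ∀ w' → (w ≡M w') ⇔ (w ≡₁ w'))
theorem4p3 =
    -- Each word represents itself, so a class may have several representatives, such as ac and ca.
    (candidates , λ w sf → w , ClassSquareFree⇒∈-candidates w sf , refl)
  , λ w sf w' → mk⇔
      (λ w≡w' → nf-≡⇒≡₁ w w'
        (All-lookup
          (All-lookup candidates-≡M⇒nf-≡ (ClassSquareFree⇒∈-candidates w sf))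
          (ClassSquareFree⇒∈-candidates w' (ClassSquareFree-resp-≡M {w} {w'} w≡w' sf))
          w≡w'))
      ≡₁⇒≡M
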